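{- For every integer $k\ge1$ there is a constant $c_k$ such that for all integers $n\ge1$, $r_o(S_k',P_n)\le n+c_k$.
   Context: An ordered graph is a graph with a linear ordering on its vertices; subgraphs inherit the ordering, and copies are taken via order-preserving isomorphisms. The ordered path $P_n$ has vertices $v_1<\dots<v_n$ and edges $v_iv_{i+1}$. The nested matching $N_k$ is the ordered graph with vertices $v_1<\dots<v_k<w_k<\dots<w_1$ and edges $v_1w_1,\dots,v_kw_k$. The partial St.~Ives matching $S_k'$ is the ordered matching obtained from $N_k$ by adding $k$ further vertex-disjoint copies of $N_k$, placed consecutively (each entirely to the left of the next), all of whose vertices lie strictly between $v_k$ and $w_k$. The online ordered Ramsey game for ordered graphs $G,H$ is played on vertex set $\mathbb N$ with its usual order: on each turn Builder draws a new edge between two vertices and Painter colors it red or blue; the game ends when there is a red copy of $G$ or a blue copy of $H$. Builder minimizes and Painter maximizes the number of turns; $r_o(G,H)$ is the number of turns under optimal play. -}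

module Defs where

open import Data.Nat using (ℕ; zero; suc; _+_; _*_; _<_; _≤_)
open import Data.Fin using (Fin; toℕ)
open import Data.Product using (Σ; _×_; _,_)
open import Data.Sum using (_⊎_)
open import Data.List using (List; []; _∷_)
open import Data.List.Membership.Propositional using (_∈_)
open import Relation.Nullary using (¬_)
open import Relation.Binary.PropositionalEquality using (_≡_)

-- An ordered graph: vertices Fin size, ordered by toℕ; Edge i j says ij is an edge.
record OGraph : Set₁ where
  field
    size : ℕ
    Edge : Fin size → Fin size → Set
open OGraph public

P : ℕ → OGraph
P n = record { size = n ; Edge = λ i j → suc (toℕ i) ≡ toℕ j }

-- Partial St. Ives matching S'_k, on 2k(k+1) vertices (0-indexed positions):
--   positions 0..k-1 are v_1..v_k, then k consecutive copies of N_k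
--   (copy t occupies positions k+2kt .. k+2kt+2k-1), then w_k..w_1.
--   Outer edges: x ~ y with x < k and x + y + 1 = 2k + 2k·k.
--   Inner edges of copy t: (k+2kt+i) ~ y with i < k and y + i + 1 = k + 2kt + 2k.
SEdgeℕ : ℕ → ℕ → ℕ → Set
SEdgeℕ k x y =
  (x < k × x + y + 1 ≡ 2 * k + 2 * (k * k))
  ⊎ Σ ℕ (λ t → Σ ℕ (λ i → t < k × i < k × x ≡ k + 2 * k * t + i
                            × y + i + 1 ≡ k + 2 * k * t + 2 * k))

S' : ℕ → OGraph
S' k = record { size = 2 * k * (k + 1) ; Edge = λ i j → SEdgeℕ k (toℕ i) (toℕ j) }

data Colour : Set where
  red blue : Colour

Board : Set
Board = List (ℕ × ℕ × Colour)

HasEdge : Board → Colour → ℕ → ℕ → Set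
HasEdge B c x y = ((x , y , c) ∈ B) ⊎ ((y , x , c) ∈ B)

Drawn : Board → ℕ → ℕ → Set
Drawn B x y = Σ Colour (λ c → HasEdge B c x y)

CopyIn : Board → Colour → OGraph → Set
CopyIn B c G = Σ (Fin (size G) → ℕ) (λ f →
  ((i j : Fin (size G)) → toℕ i < toℕ j → f i < f j)
  × ((i j : Fin (size G)) → Edge G i j → HasEdge B c (f i) (f j)))

Ended : OGraph → OGraph → Board → Set
Ended G H B = CopyIn B red G ⊎ CopyIn B blue H

data BuilderWins (G H : OGraph) : ℕ → Board → Set where
  done : ∀ {m B} → Ended G H B → BuilderWins G H m B
  move : ∀ {m B} (a b : ℕ) → a < b → ¬ Drawn B a b →
         ((c : Colour) → BuilderWins G H m ((a , b , c) ∷ B)) →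
         BuilderWins G H (suc m) B

RoLe : OGraph → OGraph → ℕ → Set
RoLe G H m = BuilderWins G H m []

module Submission where

-- Builder plays on ℚ, where there is always room next to a vertex; a finite strategy is then
-- relabelled into ℕ. She extends one blue path to the right, inside a bounded interval.
-- Whenever Painter answers red with an edge xw, she builds a short blue path between x and w and
-- draws the nested edges from the last k path vertices to its first k vertices. Either one of
-- these is blue and the path, a constant shorter, continues inside xw ("a level is gained"), or
-- all are red: then they form a copy of N_k, the path is cut back by k vertices, and play goes on
-- to the left of this copy. If k such copies pile up before a level is gained, Builder tries to
-- jump over all of them but below the w of the first red edge: if all k nested edges are red
-- they enclose k copies of N_k, an S'_k, and otherwise a level is gained after all. So k levels,
-- i.e. a red N_k around the end of the path, cost a constant. The first such N_k is kept as the
-- outer matching of S'_k. Inside it, each further N_k around the end of the path is followed by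
-- an attempt to jump over it to the right, which leaves a copy of N_k either entirely to the left
-- of the end of the path or entirely to its right; after k rounds there is a red S'_k.

open import Defs
open import Data.Fin using (Fin; toℕ)
open import Data.Fin.Properties using (toℕ<n)
open import Data.List using (List; []; _∷_; _++_; [_]; length; map; tabulate)
open import Data.List.Membership.Propositional using (_∈_)
open import Data.List.Membership.Propositional.Properties
  using (∈-map⁺; ∈-map⁻; ∈-++⁺ˡ; ∈-++⁺ʳ; ∈-tabulate⁺)
open import Data.List.Properties using (length-++)
open import Data.List.Relation.Binary.Subset.Propositional using (_⊆_)
open import Data.List.Relation.Unary.All as All using (All; []; _∷_)
import Data.List.Relation.Unary.All.Properties as Allₚ
open import Data.List.Relation.Unary.AllPairs as AllPairs using (AllPairs; []; _∷_)
import Data.List.Relation.Unary.AllPairs.Properties as AllPairsₚ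
open import Data.List.Relation.Unary.Any using (here; there)
open import Data.List.Relation.Unary.Linked as Linked using (Linked; [-]; _∷_)
open import Data.List.Relation.Unary.Linked.Properties using (Linked⇒AllPairs)
open import Data.Nat using (ℕ; zero; suc; _+_; _*_; _∸_; _<_; _≤_; z≤n; s≤s)
import Data.Nat.Properties as ℕₚ
open import Data.Nat.Tactic.RingSolver using (solve-∀)
open import Data.Product using (Σ; ∃; ∃₂; _×_; _,_; proj₁; proj₂)
open import Data.Product.Properties using (,-injective)
open import Data.Rational using (ℚ; 0ℚ; 1ℚ) renaming (_<_ to _≺_; _≤_ to _≼_)
import Data.Rational.Properties as ℚₚ
open import Data.Sum using (_⊎_; inj₁; inj₂; [_,_]′)
open import Function using (_∘_; id)
open import Relation.Binary using (tri<; tri≈; tri>)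
open import Relation.Binary.PropositionalEquality using (_≡_; refl; sym; trans; cong; cong₂; subst)
open import Relation.Nullary using (¬_; yes; no; contradiction)

-- The game on ℚ and its relabelling into ℕ.

Boardℚ : Set
Boardℚ = List (ℚ × ℚ × Colour)

HasEdgeℚ : Boardℚ → Colour → ℚ → ℚ → Set
HasEdgeℚ B c x y = ((x , y , c) ∈ B) ⊎ ((y , x , c) ∈ B)

Drawnℚ : Boardℚ → ℚ → ℚ → Set
Drawnℚ B x y = Σ Colour (λ c → HasEdgeℚ B c x y)

CopyInℚ : Boardℚ → Colour → OGraph → Set
CopyInℚ B c G = Σ (Fin (size G) → ℚ) (λ f →
  ((i j : Fin (size G)) → toℕ i < toℕ j → f i ≺ f j)
  × ((i j : Fin (size G)) → Edge G i j → HasEdgeℚ B c (f i) (f j)))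

data Winsℚ (G H : OGraph) : ℕ → Boardℚ → Set where
  done : ∀ {m B} → CopyInℚ B red G ⊎ CopyInℚ B blue H → Winsℚ G H m B
  move : ∀ {m B} (a b : ℚ) → a ≺ b → ¬ Drawnℚ B a b →
         ((c : Colour) → Winsℚ G H m ((a , b , c) ∷ B)) → Winsℚ G H (suc m) B

weaken : ∀ {G H m m′ B} → m ≤ m′ → Winsℚ G H m B → Winsℚ G H m′ B
weaken _         (done e)             = done e
weaken (s≤s m≤m′) (move a b a≺b new σ) = move a b a≺b new (weaken m≤m′ ∘ σ)

rank : List ℚ → ℚ → ℕ
rank []      x = 0
rank (z ∷ L) x with z ℚₚ.<? x
... | yes _ = suc (rank L x)
... | no  _ = rank L x

rank-mono-≤ : ∀ L {x y} → x ≺ y → rank L x ≤ rank L y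
rank-mono-≤ []      x≺y = z≤n
rank-mono-≤ (z ∷ L) {x} {y} x≺y with z ℚₚ.<? x | z ℚₚ.<? y
... | yes _   | yes _   = s≤s (rank-mono-≤ L x≺y)
... | yes z≺x | no  z⊀y = contradiction (ℚₚ.<-trans z≺x x≺y) z⊀y
... | no  _   | yes _   = ℕₚ.m≤n⇒m≤1+n (rank-mono-≤ L x≺y)
... | no  _   | no  _   = rank-mono-≤ L x≺y

-- The entry `x` of `L` is counted for `y` but not for `x` itself.
rank-mono-< : ∀ {L x y} → x ∈ L → x ≺ y → rank L x < rank L y
rank-mono-< {z ∷ L} {x} {y} x∈ x≺y with z ℚₚ.<? x | z ℚₚ.<? y
rank-mono-< (here refl) x≺y | yes x≺x | _       = contradiction x≺x (ℚₚ.<-irrefl refl)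
rank-mono-< {z ∷ L} (here refl) x≺y | no _ | yes _ = s≤s (rank-mono-≤ L x≺y)
rank-mono-< (here refl) x≺y | no _    | no x⊀y  = contradiction x≺y x⊀y
rank-mono-< (there x∈)  x≺y | yes _   | yes _   = s≤s (rank-mono-< x∈ x≺y)
rank-mono-< (there x∈)  x≺y | yes z≺x | no z⊀y  = contradiction (ℚₚ.<-trans z≺x x≺y) z⊀y
rank-mono-< (there x∈)  x≺y | no _    | yes _   = ℕₚ.m≤n⇒m≤1+n (rank-mono-< x∈ x≺y)
rank-mono-< (there x∈)  x≺y | no _    | no _    = rank-mono-< x∈ x≺y

-- Both replies of Painter are followed, so that one relabelling serves all plays. The final copies
-- are included since they may have isolated vertices, as for `P 1`.
strategyVertices : ∀ {G H m B} → Winsℚ G H m B → List ℚ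
strategyVertices (done (inj₁ (f , _))) = tabulate f
strategyVertices (done (inj₂ (f , _))) = tabulate f
strategyVertices (move a b _ _ σ)      =
  a ∷ b ∷ strategyVertices (σ red) ++ strategyVertices (σ blue)

module Relabel (L : List ℚ) where

  relabelEdge : ℚ × ℚ × Colour → ℕ × ℕ × Colour
  relabelEdge (x , y , c) = rank L x , rank L y , c

  relabel : Boardℚ → Board
  relabel = map relabelEdge

  VerticesIn : Boardℚ → Set
  VerticesIn = All (λ (x , y , _) → x ∈ L × y ∈ L)

  rank-injective : ∀ {x y} → x ∈ L → y ∈ L → rank L x ≡ rank L y → x ≡ y
  rank-injective {x} {y} x∈ y∈ eq with ℚₚ.<-cmp x y
  ... | tri< x≺y _ _ = contradiction eq (ℕₚ.<⇒≢ (rank-mono-< x∈ x≺y))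
  ... | tri≈ _ x≡y _ = x≡y
  ... | tri> _ _ y≺x = contradiction (sym eq) (ℕₚ.<⇒≢ (rank-mono-< y∈ y≺x))

  -- Injectivity on `L` keeps vertices apart, so a new edge is still new after relabelling.
  edge⁻ : ∀ {B a b c} → VerticesIn B → a ∈ L → b ∈ L →
          (rank L a , rank L b , c) ∈ relabel B → (a , b , c) ∈ B
  edge⁻ {B} vs a∈ b∈ e with ∈-map⁻ relabelEdge e
  ... | (x , y , c) , e′ , eq with ,-injective eq
  ... | eq₁ , eq₂ with ,-injective eq₂ | All.lookup vs e′
  ... | eq₃ , refl | x∈ , y∈
    with refl ← rank-injective a∈ x∈ eq₁ | refl ← rank-injective b∈ y∈ eq₃ = e′

  hasEdge⁺ : ∀ {B c x y} → HasEdgeℚ B c x y → HasEdge (relabel B) c (rank L x) (rank L y)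
  hasEdge⁺ (inj₁ e) = inj₁ (∈-map⁺ relabelEdge e)
  hasEdge⁺ (inj₂ e) = inj₂ (∈-map⁺ relabelEdge e)

  copy⁺ : ∀ {B c G} ((f , _) : CopyInℚ B c G) → tabulate f ⊆ L → CopyIn (relabel B) c G
  copy⁺ (f , mono , edges) f⊆L =
    rank L ∘ f , (λ i j i<j → rank-mono-< (f⊆L (∈-tabulate⁺ i)) (mono i j i<j)) ,
    (λ i j e → hasEdge⁺ (edges i j e))

  wins⁺ : ∀ {G H m B} (w : Winsℚ G H m B) → strategyVertices w ⊆ L → VerticesIn B →
          BuilderWins G H m (relabel B)
  wins⁺ (done (inj₁ copy)) w⊆L vs = done (inj₁ (copy⁺ copy w⊆L))
  wins⁺ (done (inj₂ copy)) w⊆L vs = done (inj₂ (copy⁺ copy w⊆L))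
  wins⁺ (move a b a≺b new σ) w⊆L vs =
    move (rank L a) (rank L b) (rank-mono-< a∈ a≺b)
      (λ { (c , inj₁ e) → new (c , inj₁ (edge⁻ vs a∈ b∈ e))
         ; (c , inj₂ e) → new (c , inj₂ (edge⁻ vs b∈ a∈ e)) })
      λ { red  → wins⁺ (σ red) (w⊆L ∘ there ∘ there ∘ ∈-++⁺ˡ) ((a∈ , b∈) ∷ vs)
        ; blue → wins⁺ (σ blue) (w⊆L ∘ there ∘ there ∘ ∈-++⁺ʳ (strategyVertices (σ red)))
                   ((a∈ , b∈) ∷ vs) }
    where
    a∈ = w⊆L (here refl)
    b∈ = w⊆L (there (here refl))

winsℚ⇒roLe : ∀ {G H m} → Winsℚ G H m [] → RoLe G H m
winsℚ⇒roLe w = Relabel.wins⁺ (strategyVertices w) w id []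

-- Positions in lists, and copies read off from sorted lists.

data At {A : Set} : List A → ℕ → A → Set where
  zeroᵗʰ : ∀ {x xs} → At (x ∷ xs) 0 x
  sucᵗʰ  : ∀ {x y xs i} → At xs i y → At (x ∷ xs) (suc i) y

at-exists : ∀ {A} (xs : List A) {i} → i < length xs → ∃ (At xs i)
at-exists (x ∷ xs) {zero}  _         = x , zeroᵗʰ
at-exists (x ∷ xs) {suc i} (s≤s i<l) with at-exists xs i<l
... | y , p = y , sucᵗʰ p

at-unique : ∀ {A} {xs : List A} {i x y} → At xs i x → At xs i y → x ≡ y
at-unique zeroᵗʰ    zeroᵗʰ    = refl
at-unique (sucᵗʰ p) (sucᵗʰ q) = at-unique p q

at-++ˡ : ∀ {A} {xs ys : List A} {i x} → At xs i x → At (xs ++ ys) i x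
at-++ˡ zeroᵗʰ    = zeroᵗʰ
at-++ˡ (sucᵗʰ p) = sucᵗʰ (at-++ˡ p)

at-++ʳ : ∀ {A} (xs : List A) {ys i x} → At ys i x → At (xs ++ ys) (length xs + i) x
at-++ʳ []       p = p
at-++ʳ (x ∷ xs) p = sucᵗʰ (at-++ʳ xs p)

at-∈ : ∀ {A} {xs : List A} {i x} → At xs i x → x ∈ xs
at-∈ zeroᵗʰ    = here refl
at-∈ (sucᵗʰ p) = there (at-∈ p)

at-pairs : ∀ {A} {R : A → A → Set} {xs i j x y} → AllPairs R xs → i < j → At xs i x → At xs j y → R x y
at-pairs (r ∷ _)  _         zeroᵗʰ    (sucᵗʰ q) = All.lookup r (at-∈ q)
at-pairs (_ ∷ rs) (s≤s i<j) (sucᵗʰ p) (sucᵗʰ q) = at-pairs rs i<j p q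

at-linked : ∀ {A} {R : A → A → Set} {xs i x y} → Linked R xs → At xs i x → At xs (suc i) y → R x y
at-linked (r ∷ _)  zeroᵗʰ    (sucᵗʰ zeroᵗʰ) = r
at-linked (_ ∷ rs) (sucᵗʰ p) (sucᵗʰ q)      = at-linked rs p q

copyFromList : ∀ {B c} G xs → AllPairs _≺_ xs → size G ≤ length xs →
  (∀ i j → Edge G i j → ∀ {u v} → At xs (toℕ i) u → At xs (toℕ j) v → (u , v , c) ∈ B) →
  CopyInℚ B c G
copyFromList G xs sorted size≤ edges =
  (λ i → proj₁ (vertex i)) ,
  (λ i j i<j → at-pairs sorted i<j (proj₂ (vertex i)) (proj₂ (vertex j))) ,
  (λ i j e → inj₁ (edges i j e (proj₂ (vertex i)) (proj₂ (vertex j))))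
  where
  vertex : ∀ i → ∃ (At xs (toℕ i))
  vertex i = at-exists xs (ℕₚ.<-≤-trans (toℕ<n i) size≤)

-- Nested red matchings and their assembly into S'_k.

Between : ℚ → List ℚ → ℚ → Set
Between a xs b = AllPairs _≺_ xs × All (λ x → a ≺ x × x ≺ b) xs

between-++ : ∀ {a x b xs ys} → a ≼ x → x ≼ b → Between a xs x → Between x ys b → Between a (xs ++ ys) b
between-++ a≼x x≼b (sx , bx) (sy , by) =
  AllPairsₚ.++⁺ sx sy (All.map (λ (_ , u≺x) → All.map (λ (x≺v , _) → ℚₚ.<-trans u≺x x≺v) by) bx) ,
  Allₚ.++⁺ (All.map (λ (a≺u , u≺x) → a≺u , ℚₚ.<-≤-trans u≺x x≼b) bx)
           (All.map (λ (x≺u , u≺b) → ℚₚ.≤-<-trans a≼x x≺u , u≺b) by)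

between-wrap : ∀ {a x w b zs} → a ≺ x → x ≺ w → w ≺ b → Between x zs w → Between a (x ∷ zs ++ [ w ]) b
between-wrap a≺x x≺w w≺b (sz , bz) =
  (Allₚ.++⁺ (All.map proj₁ bz) (x≺w ∷ []) ∷
    AllPairsₚ.++⁺ sz ([] ∷ []) (All.map (λ (_ , u≺w) → u≺w ∷ []) bz)) ,
  (a≺x , ℚₚ.<-trans x≺w w≺b) ∷
    Allₚ.++⁺ (All.map (λ (x≺u , u≺w) → ℚₚ.<-trans a≺x x≺u , ℚₚ.<-trans u≺w w≺b) bz)
             ((ℚₚ.<-trans a≺x x≺w , w≺b) ∷ [])

-- A red nested matching with j edges, all left ends in (a , c] and all right ends in [d , b).
data Nest (B : Boardℚ) : ℕ → (a b c d : ℚ) → Set where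
  hole : ∀ {a b} → Nest B 0 a b a b
  wrap : ∀ {j a b x w c d} → a ≺ x → x ≺ w → w ≺ b → (x , w , red) ∈ B →
         Nest B j x w c d → Nest B (suc j) a b c d

data Copies (B : Boardℚ) (k : ℕ) : ℕ → (a b : ℚ) → Set where
  none : ∀ {a b} → a ≼ b → Copies B k 0 a b
  _∷_  : ∀ {j a x b c d} → Nest B k a x c d → Copies B k j x b → Copies B k (suc j) a b

nestVertices : ∀ {B j a b c d} → Nest B j a b c d → List ℚ → List ℚ
nestVertices hole                               zs = zs
nestVertices (wrap {x = x} {w = w} _ _ _ _ N) zs = x ∷ nestVertices N zs ++ [ w ]

length-nestVertices : ∀ {B j a b c d} (N : Nest B j a b c d) zs →
  length (nestVertices N zs) ≡ j + (length zs + j)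
length-nestVertices hole zs = sym (ℕₚ.+-identityʳ _)
length-nestVertices {j = suc j} (wrap {w = w} _ _ _ _ N) zs
  rewrite length-++ (nestVertices N zs) {[ w ]} | length-nestVertices N zs =
  cong suc (shift j (length zs))
  where
  shift : ∀ j l → j + (l + j) + 1 ≡ j + (l + suc j)
  shift = solve-∀

nest-between : ∀ {B j a b c d zs} (N : Nest B j a b c d) → Between c zs d →
  Between a (nestVertices N zs) b
nest-between hole                     I = I
nest-between (wrap a≺x x≺w w≺b _ N) I = between-wrap a≺x x≺w w≺b (nest-between N I)

nest-at : ∀ {B j a b c d zs i z} (N : Nest B j a b c d) → At zs i z → At (nestVertices N zs) (j + i) z
nest-at hole             p = p
nest-at (wrap _ _ _ _ N) p = sucᵗʰ (at-++ˡ (nest-at N p))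

-- The equation makes `i` and `i′` mirror images in the vertex list; removing the outermost edge
-- shifts both by one.
nest-edge : ∀ {B j a b c d} (N : Nest B j a b c d) zs {i i′} → i < j →
  i + suc i′ ≡ j + (length zs + j) →
  ∃₂ λ u v → (u , v , red) ∈ B × At (nestVertices N zs) i u × At (nestVertices N zs) i′ v
nest-edge {j = suc j} (wrap {x = x} {w = w} _ _ _ e N) zs {zero} {i′} _ eq =
  x , w , e , zeroᵗʰ , subst (λ l → At _ l w) index (sucᵗʰ (at-++ʳ (nestVertices N zs) zeroᵗʰ))
  where
  shift : ∀ j l → suc (j + (l + j) + 0) ≡ j + (l + suc j)
  shift = solve-∀
  index : suc (length (nestVertices N zs) + 0) ≡ i′
  index rewrite length-nestVertices N zs = trans (shift j (length zs)) (sym (ℕₚ.suc-injective eq))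
nest-edge {j = suc j} (wrap _ _ _ _ N) zs {suc i} {zero} (s≤s i<j) eq =
  contradiction (ℕₚ.suc-injective eq)
    (ℕₚ.<⇒≢ (ℕₚ.≤-<-trans (subst (_≤ j) (ℕₚ.+-comm 1 i) i<j)
                           (subst (j <_) (cong (j +_) (sym (ℕₚ.+-suc (length zs) j))) (ℕₚ.m<m+n j (s≤s z≤n)))))
nest-edge {j = suc j} (wrap _ _ _ _ N) zs {suc i} {suc i′} (s≤s i<j) eq
  with nest-edge N zs i<j (ℕₚ.suc-injective (trans (sym (ℕₚ.+-suc i (suc i′)))
         (trans (ℕₚ.suc-injective eq) (shift j (length zs)))))
  where
  shift : ∀ j l → j + (l + suc j) ≡ suc (j + (l + j))
  shift = solve-∀
... | u , v , e , p , q = u , v , e , sucᵗʰ (at-++ˡ p) , sucᵗʰ (at-++ˡ q)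

-- An edge is needed: `hole` does not order its two bounds. Hence the `suc` in many statements
-- below.
nest-≼ : ∀ {B j a b c d} → Nest B (suc j) a b c d → a ≼ b
nest-≼ (wrap a≺x x≺w w≺b _ _) = ℚₚ.<⇒≤ (ℚₚ.<-trans a≺x (ℚₚ.<-trans x≺w w≺b))

copies-≼ : ∀ {B k j a b} → Copies B (suc k) j a b → a ≼ b
copies-≼ (none a≼b) = a≼b
copies-≼ (N ∷ C)    = ℚₚ.≤-trans (nest-≼ N) (copies-≼ C)

copiesVertices : ∀ {B k j a b} → Copies B k j a b → List ℚ
copiesVertices (none _) = []
copiesVertices (N ∷ C)  = nestVertices N [] ++ copiesVertices C

length-copiesVertices : ∀ {B k j a b} (C : Copies B k j a b) →
  length (copiesVertices C) ≡ j * (k + k)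
length-copiesVertices (none _) = refl
length-copiesVertices (N ∷ C)  =
  trans (length-++ (nestVertices N [])) (cong₂ _+_ (length-nestVertices N []) (length-copiesVertices C))

copies-between : ∀ {B k j a b} (C : Copies B (suc k) j a b) → Between a (copiesVertices C) b
copies-between (none _) = [] , []
copies-between (N ∷ C)  =
  between-++ (nest-≼ N) (copies-≼ C) (nest-between N ([] , [])) (copies-between C)

copies-edge : ∀ {B k j a b} (C : Copies B k j a b) {t i i′} → t < j → i < k → i + suc i′ ≡ k + k →
  ∃₂ λ u v → (u , v , red) ∈ B × At (copiesVertices C) (t * (k + k) + i) u
                               × At (copiesVertices C) (t * (k + k) + i′) v
copies-edge (N ∷ C) {zero} _ i<k eq with nest-edge N [] i<k eq
... | u , v , e , p , q = u , v , e , at-++ˡ p , at-++ˡ q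
copies-edge {k = k} (N ∷ C) {suc t} {i} {i′} (s≤s t<j) i<k eq with copies-edge C t<j i<k eq
... | u , v , e , p , q = u , v , e , later p , later q
  where
  later : ∀ {m z} → At (copiesVertices C) (t * (k + k) + m) z →
          At (copiesVertices (N ∷ C)) (k + k + t * (k + k) + m) z
  later {m} {z} p = subst (λ l → At (copiesVertices (N ∷ C)) l z)
    (trans (cong (_+ (t * (k + k) + m)) (length-nestVertices N [])) (sym (ℕₚ.+-assoc (k + k) _ m)))
    (at-++ʳ (nestVertices N []) p)

stIves : ∀ {B k a b c d} → Nest B (suc k) a b c d → Copies B (suc k) (suc k) c d →
  CopyInℚ B red (S' (suc k))
stIves {B} {k′} N C = copyFromList (S' k) vs (proj₁ (nest-between N (copies-between C)))
  (ℕₚ.≤-reflexive size≡) edges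
  where
  k = suc k′
  zs = copiesVertices C
  vs = nestVertices N zs

  total : ∀ k → 2 * k * (k + 1) ≡ k + (k * (k + k) + k)
  total = solve-∀

  size≡ : 2 * k * (k + 1) ≡ length vs
  size≡ rewrite length-nestVertices N zs | length-copiesVertices C = total k

  edge-at : ∀ {x y} → ∃₂ (λ u v → (u , v , red) ∈ B × At vs x u × At vs y v) →
            ∀ {u v} → At vs x u → At vs y v → (u , v , red) ∈ B
  edge-at (_ , _ , e , p , q) p′ q′ with refl ← at-unique p p′ | refl ← at-unique q q′ = e

  edges : ∀ i j → SEdgeℕ k (toℕ i) (toℕ j) → ∀ {u v} → At vs (toℕ i) u → At vs (toℕ j) v →
          (u , v , red) ∈ B
  edges i j (inj₁ (x<k , eq)) = edge-at (nest-edge N zs x<k outer)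
    where
    outer : toℕ i + suc (toℕ j) ≡ k + (length zs + k)
    outer rewrite length-copiesVertices C =
      trans (shift₁ (toℕ i) (toℕ j)) (trans eq (shift₂ k))
      where
      shift₁ : ∀ x y → x + suc y ≡ x + y + 1
      shift₁ = solve-∀
      shift₂ : ∀ k → 2 * k + 2 * (k * k) ≡ k + (k * (k + k) + k)
      shift₂ = solve-∀
  edges i j (inj₂ (t , m , t<k , m<k , eqˣ , eqʸ)) = edge-at inner
    where
    -- The mirror image of `m` among the 2k positions of copy `t`.
    m′ = k + k ∸ suc m
    m+m′ : m + suc m′ ≡ k + k
    m+m′ = trans (ℕₚ.+-suc m m′) (ℕₚ.m+[n∸m]≡n (ℕₚ.≤-trans m<k (ℕₚ.m≤m+n k k)))
    x≡ : k + (t * (k + k) + m) ≡ toℕ i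
    x≡ = trans (shift k t m) (sym eqˣ)
      where
      shift : ∀ k t m → k + (t * (k + k) + m) ≡ k + 2 * k * t + m
      shift = solve-∀
    y≡ : k + (t * (k + k) + m′) ≡ toℕ j
    y≡ = ℕₚ.+-cancelʳ-≡ (m + 1) _ _
      (trans (shift₁ k t m m′) (trans (cong (k + 2 * k * t +_) m+m′)
        (trans (shift₂ k t) (trans (sym eqʸ) (ℕₚ.+-assoc (toℕ j) m 1)))))
      where
      shift₁ : ∀ k t m m′ → k + (t * (k + k) + m′) + (m + 1) ≡ k + 2 * k * t + (m + suc m′)
      shift₁ = solve-∀
      shift₂ : ∀ k t → k + 2 * k * t + (k + k) ≡ k + 2 * k * t + 2 * k
      shift₂ = solve-∀
    inner : ∃₂ (λ u v → (u , v , red) ∈ B × At vs (toℕ i) u × At vs (toℕ j) v)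
    inner with copies-edge C t<k m<k m+m′
    ... | u , v , e , p , q =
      u , v , e , subst (λ l → At vs l u) x≡ (nest-at N p) , subst (λ l → At vs l v) y≡ (nest-at N q)

nest-mono : ∀ {B B′ j a b c d} → B ⊆ B′ → Nest B j a b c d → Nest B′ j a b c d
nest-mono B⊆B′ hole                     = hole
nest-mono B⊆B′ (wrap a≺x x≺w w≺b e N) = wrap a≺x x≺w w≺b (B⊆B′ e) (nest-mono B⊆B′ N)

copies-mono : ∀ {B B′ k j a b} → B ⊆ B′ → Copies B k j a b → Copies B′ k j a b
copies-mono B⊆B′ (none a≼b) = none a≼b
copies-mono B⊆B′ (N ∷ C)    = nest-mono B⊆B′ N ∷ copies-mono B⊆B′ C

nest-widenˡ : ∀ {B j a′ a b c d} → a′ ≼ a → Nest B (suc j) a b c d → Nest B (suc j) a′ b c d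
nest-widenˡ a′≼a (wrap a≺x x≺w w≺b e N) = wrap (ℚₚ.≤-<-trans a′≼a a≺x) x≺w w≺b e N

nest-widenʳ : ∀ {B j a b b′ c d} → b ≼ b′ → Nest B (suc j) a b c d → Nest B (suc j) a b′ c d
nest-widenʳ b≼b′ (wrap a≺x x≺w w≺b e N) = wrap a≺x x≺w (ℚₚ.<-≤-trans w≺b b≼b′) e N

-- Used with the blue path ending at `a`: by density there is room to extend it to the left of the
-- copy.
nest-narrowˡ : ∀ {B j a b c d} → Nest B (suc j) a b c d → ∃ λ a′ → a ≺ a′ × Nest B (suc j) a′ b c d
nest-narrowˡ (wrap a≺x x≺w w≺b e N) with ℚₚ.<-dense a≺x
... | a′ , a≺a′ , a′≺x = a′ , a≺a′ , wrap a′≺x x≺w w≺b e N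

nest-narrowʳ : ∀ {B j a b c d} → Nest B (suc j) a b c d → ∃ λ b′ → b′ ≺ b × Nest B (suc j) a b′ c d
nest-narrowʳ (wrap a≺x x≺w w≺b e N) with ℚₚ.<-dense w≺b
... | b′ , w≺b′ , b′≺b = b′ , b′≺b , wrap a≺x x≺w w≺b′ e N

nest-left : ∀ {B j a b c d} → Nest B (suc j) a b c d → a ≺ c
nest-left (wrap a≺x _ _ _ hole)                    = a≺x
nest-left (wrap a≺x _ _ _ N@(wrap _ _ _ _ _)) = ℚₚ.<-trans a≺x (nest-left N)

nest-right : ∀ {B j a b c d} → Nest B (suc j) a b c d → d ≺ b
nest-right (wrap _ _ w≺b _ hole)                    = w≺b
nest-right (wrap _ _ w≺b _ N@(wrap _ _ _ _ _)) = ℚₚ.<-trans (nest-right N) w≺b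

copies-widenˡ : ∀ {B k j a′ a b} → a′ ≼ a → Copies B (suc k) j a b → Copies B (suc k) j a′ b
copies-widenˡ a′≼a (none a≼b) = none (ℚₚ.≤-trans a′≼a a≼b)
copies-widenˡ a′≼a (N ∷ C)    = nest-widenˡ a′≼a N ∷ C

copies-widenʳ : ∀ {B k j a b b′} → b ≼ b′ → Copies B k j a b → Copies B k j a b′
copies-widenʳ b≼b′ (none a≼b) = none (ℚₚ.≤-trans a≼b b≼b′)
copies-widenʳ b≼b′ (N ∷ C)    = N ∷ copies-widenʳ b≼b′ C

copies-snoc : ∀ {B k j a x b c d} → Copies B (suc k) j a x → Nest B (suc k) x b c d →
  Copies B (suc k) (suc j) a b
copies-snoc (none a≼x) N = nest-widenˡ a≼x N ∷ none ℚₚ.≤-refl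
copies-snoc (M ∷ C)    N = M ∷ copies-snoc C N

copies-++ : ∀ {B k i j a x y b} → Copies B (suc k) i a x → x ≼ y → Copies B (suc k) j y b →
  Copies B (suc k) (i + j) a b
copies-++ (none a≼x) x≼y D = copies-widenˡ (ℚₚ.≤-trans a≼x x≼y) D
copies-++ (N ∷ C)    x≼y D = N ∷ copies-++ C x≼y D

-- Untouched intervals and local extensions of the board.

drawn-∷⁻ : ∀ {x y c B u v} → Drawnℚ ((x , y , c) ∷ B) u v →
  (u ≡ x × v ≡ y) ⊎ (u ≡ y × v ≡ x) ⊎ Drawnℚ B u v
drawn-∷⁻ (_ , inj₁ (here refl)) = inj₁ (refl , refl)
drawn-∷⁻ (_ , inj₂ (here refl)) = inj₂ (inj₁ (refl , refl))
drawn-∷⁻ (c , inj₁ (there e))   = inj₂ (inj₂ (c , inj₁ e))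
drawn-∷⁻ (c , inj₂ (there e))   = inj₂ (inj₂ (c , inj₂ e))

drawn-sym : ∀ {B u v} → Drawnℚ B u v → Drawnℚ B v u
drawn-sym (c , inj₁ e) = c , inj₂ e
drawn-sym (c , inj₂ e) = c , inj₁ e

Fresh : Boardℚ → ℚ → ℚ → Set
Fresh B a b = ∀ {u v} → Drawnℚ B u v → a ≺ v → ¬ (v ≺ b)

cutAt : ∀ {a b} x → a ≺ b → ∃ λ b′ → a ≺ b′ × b′ ≼ b × (a ≺ x → ¬ (x ≺ b′))
cutAt {a} {b} x a≺b with a ℚₚ.<? x | x ℚₚ.<? b
... | yes a≺x | yes x≺b = x , a≺x , ℚₚ.<⇒≤ x≺b , λ _ → ℚₚ.<-irrefl refl
... | no  a⊀x | _       = b , a≺b , ℚₚ.≤-refl , λ a≺x _ → a⊀x a≺x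
... | yes _   | no x⊀b  = b , a≺b , ℚₚ.≤-refl , λ _ → x⊀b

-- A board is finite, so its vertices stay away from some interval directly to the right of `a`.
freshAfter : ∀ B {a b} → a ≺ b → ∃ λ b′ → a ≺ b′ × b′ ≼ b × Fresh B a b′
freshAfter [] {b = b} a≺b = b , a≺b , ℚₚ.≤-refl , λ { (_ , inj₁ ()) ; (_ , inj₂ ()) }
freshAfter ((x , y , c) ∷ B) a≺b
  with b₁ , a≺b₁ , b₁≼b  , fresh ← freshAfter B a≺b
  with b₂ , a≺b₂ , b₂≼b₁ , x∉    ← cutAt x a≺b₁
  with b₃ , a≺b₃ , b₃≼b₂ , y∉    ← cutAt y a≺b₂ =
  b₃ , a≺b₃ , ℚₚ.≤-trans b₃≼b₂ (ℚₚ.≤-trans b₂≼b₁ b₁≼b) , fresh′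
  where
  fresh′ : Fresh ((x , y , c) ∷ B) _ b₃
  fresh′ e a≺v v≺b₃ with drawn-∷⁻ e
  ... | inj₁ (_ , refl)        = y∉ a≺v v≺b₃
  ... | inj₂ (inj₁ (_ , refl)) = x∉ a≺v (ℚₚ.<-≤-trans v≺b₃ b₃≼b₂)
  ... | inj₂ (inj₂ e′)         = fresh e′ a≺v (ℚₚ.<-≤-trans v≺b₃ (ℚₚ.≤-trans b₃≼b₂ b₂≼b₁))

Inside : ℚ → ℚ → ℚ → Set
Inside a b x = a ≺ x × x ≺ b

-- After a subroutine has played, `local` shows that edges elsewhere are still undrawn.
record Extends (B B′ : Boardℚ) (a b : ℚ) : Set where
  constructor extends
  field
    incl  : B ⊆ B′
    local : ∀ {u v} → Drawnℚ B′ u v → Drawnℚ B u v ⊎ (Inside a b u × Inside a b v)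
open Extends

extends-refl : ∀ {B a b} → Extends B B a b
extends-refl = extends id inj₁

extends-trans : ∀ {B B′ B″ a b} → Extends B B′ a b → Extends B′ B″ a b → Extends B B″ a b
extends-trans E F = extends (incl F ∘ incl E) λ e → [ local E , inj₂ ]′ (local F e)

extends-∷ : ∀ {B x y c a b} → Inside a b x → Inside a b y → Extends B ((x , y , c) ∷ B) a b
extends-∷ {B} {x} {y} {c} {a} {b} x∈ y∈ = extends there local′
  where
  local′ : ∀ {u v} → Drawnℚ ((x , y , c) ∷ B) u v → Drawnℚ B u v ⊎ (Inside a b u × Inside a b v)
  local′ e with drawn-∷⁻ e
  ... | inj₁ (refl , refl)        = inj₂ (x∈ , y∈)
  ... | inj₂ (inj₁ (refl , refl)) = inj₂ (y∈ , x∈)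
  ... | inj₂ (inj₂ e′)            = inj₁ e′

extends-widen : ∀ {B B′ a a′ b b′} → a′ ≼ a → b ≼ b′ → Extends B B′ a b → Extends B B′ a′ b′
extends-widen a′≼a b≼b′ E = extends (incl E) λ e →
  [ inj₁ , (λ (u∈ , v∈) → inj₂ (wide u∈ , wide v∈)) ]′ (local E e)
  where
  wide : ∀ {x} → Inside _ _ x → Inside _ _ x
  wide (a≺x , x≺b) = ℚₚ.≤-<-trans a′≼a a≺x , ℚₚ.<-≤-trans x≺b b≼b′

fresh-before : ∀ {B B′ a m p b} → m ≼ p → Fresh B a p → Extends B B′ m b → Fresh B′ a m
fresh-before m≼p fresh E e a≺v v≺m with local E e
... | inj₁ e′              = fresh e′ a≺v (ℚₚ.<-≤-trans v≺m m≼p)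
... | inj₂ (_ , m≺v , _) = ℚₚ.<-asym m≺v v≺m

-- Blue paths.

-- Increasing blue paths are measured by what is missing: n ≤ d + the number of vertices.
data Path (B : Boardℚ) (n : ℕ) : (d : ℕ) (v : ℚ) → Set where
  start : ∀ {d} v → n ≤ suc d → Path B n d v
  step  : ∀ {d u v} → Path B n (suc d) u → u ≺ v → (u , v , blue) ∈ B → Path B n d v

-- A path as above whose last t + 1 vertices all exceed ℓ.
data Deep (B : Boardℚ) (n : ℕ) (ℓ : ℚ) : (t d : ℕ) (v : ℚ) → Set where
  base : ∀ {d v} → Path B n d v → ℓ ≺ v → Deep B n ℓ 0 d v
  step : ∀ {t d u v} → Deep B n ℓ t (suc d) u → u ≺ v → (u , v , blue) ∈ B → Deep B n ℓ (suc t) d v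

module _ {n : ℕ} where

  path-mono : ∀ {B B′ d v} → B ⊆ B′ → Path B n d v → Path B′ n d v
  path-mono B⊆B′ (start v n≤)   = start v n≤
  path-mono B⊆B′ (step p u≺v e) = step (path-mono B⊆B′ p) u≺v (B⊆B′ e)

  path-weaken : ∀ {B d d′ v} → d ≤ d′ → Path B n d v → Path B n d′ v
  path-weaken d≤d′ (start v n≤)   = start v (ℕₚ.≤-trans n≤ (s≤s d≤d′))
  path-weaken d≤d′ (step p u≺v e) = step (path-weaken (s≤s d≤d′) p) u≺v e

  deep-mono : ∀ {B B′ ℓ t d v} → B ⊆ B′ → Deep B n ℓ t d v → Deep B′ n ℓ t d v
  deep-mono B⊆B′ (base p ℓ≺v)   = base (path-mono B⊆B′ p) ℓ≺v
  deep-mono B⊆B′ (step p u≺v e) = step (deep-mono B⊆B′ p) u≺v (B⊆B′ e)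

  deep-path : ∀ {B ℓ t d v} → Deep B n ℓ t d v → Path B n d v
  deep-path (base p _)     = p
  deep-path (step p u≺v e) = step (deep-path p) u≺v e

  deep-≺ : ∀ {B ℓ t d v} → Deep B n ℓ t d v → ℓ ≺ v
  deep-≺ (base _ ℓ≺v)   = ℓ≺v
  deep-≺ (step p u≺v _) = ℚₚ.<-trans (deep-≺ p) u≺v

  -- The path stays the same; only the guarantee about its last vertices is weakened.
  deep-pred : ∀ {B ℓ t d v} → Deep B n ℓ (suc t) d v → Deep B n ℓ t d v
  deep-pred (step p@(base _ ℓ≺u) u≺v e)   = base (deep-path (step p u≺v e)) (ℚₚ.<-trans ℓ≺u u≺v)
  deep-pred (step p@(step _ _ _) u≺v e) = step (deep-pred p) u≺v e

  deep-drop : ∀ {B ℓ t d v} m → Deep B n ℓ (m + t) d v → Deep B n ℓ t d v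
  deep-drop zero    p = p
  deep-drop (suc m) p = deep-drop m (deep-pred p)

  deep-lower : ∀ {B ℓ ℓ′ t d v} → ℓ ≼ ℓ′ → Deep B n ℓ′ t d v → Deep B n ℓ t d v
  deep-lower ℓ≼ℓ′ (base p ℓ′≺v)  = base p (ℚₚ.≤-<-trans ℓ≼ℓ′ ℓ′≺v)
  deep-lower ℓ≼ℓ′ (step p u≺v e) = step (deep-lower ℓ≼ℓ′ p) u≺v e

  -- `zs` is the part already read off to the right of `v`; it gains a vertex whenever the deficit
  -- grows by one.
  path-list : ∀ {B d v zs} → Path B n d v → d ≤ length zs →
    Linked (λ x y → x ≺ y × (x , y , blue) ∈ B) (v ∷ zs) →
    ∃ λ xs → Linked (λ x y → x ≺ y × (x , y , blue) ∈ B) xs × n ≤ length xs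
  path-list {zs = zs} (start v n≤) d≤ linked = v ∷ zs , linked , ℕₚ.≤-trans n≤ (s≤s d≤)
  path-list (step p u≺v e) d≤ linked = path-list p (s≤s d≤) ((u≺v , e) ∷ linked)

  path⇒copy : ∀ {B v} → Path B n 0 v → CopyInℚ B blue (P n)
  path⇒copy p with xs , linked , n≤ ← path-list p z≤n [-] =
    copyFromList (P n) xs (Linked⇒AllPairs ℚₚ.<-trans (Linked.map proj₁ linked)) n≤
      λ { i j eq p q → proj₂ (at-linked linked p (subst (λ l → At xs l _) (sym eq) q)) }

-- Grows at its left end, as `build` requires, whereas `Path` and `Deep` grow at the right end.
data Up (B : Boardℚ) : ℕ → (y z : ℚ) → Set where
  stop : ∀ {y} → Up B 0 y y
  hop  : ∀ {s x y z} → x ≺ y → (x , y , blue) ∈ B → Up B s y z → Up B (suc s) x z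

up-mono : ∀ {B B′ s y z} → B ⊆ B′ → Up B s y z → Up B′ s y z
up-mono B⊆B′ stop          = stop
up-mono B⊆B′ (hop x≺y e U) = hop x≺y (B⊆B′ e) (up-mono B⊆B′ U)

up-≼ : ∀ {B s y z} → Up B s y z → y ≼ z
up-≼ stop          = ℚₚ.≤-refl
up-≼ (hop x≺y _ U) = ℚₚ.≤-trans (ℚₚ.<⇒≤ x≺y) (up-≼ U)

-- A left end lies in the first half of its mirrored block. This matters because cliques store their
-- edges from left to right.
sedge-< : ∀ {k x y} → SEdgeℕ k x y → x < y
sedge-< {k} {x} {y} (inj₁ (x<k , eq)) = ℕₚ.+-cancelʳ-< (suc x) x y (begin-strict
  x + suc x             <⟨ ℕₚ.+-mono-<-≤ x<k x<k ⟩
  k + k                 ≤⟨ ℕₚ.m≤m+n (k + k) (2 * (k * k)) ⟩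
  k + k + 2 * (k * k)   ≡⟨ shift₁ k ⟩
  2 * k + 2 * (k * k)   ≡⟨ sym eq ⟩
  x + y + 1             ≡⟨ shift₂ x y ⟩
  y + suc x             ∎)
  where
  open ℕₚ.≤-Reasoning
  shift₁ : ∀ k → k + k + 2 * (k * k) ≡ 2 * k + 2 * (k * k)
  shift₁ = solve-∀
  shift₂ : ∀ x y → x + y + 1 ≡ y + suc x
  shift₂ = solve-∀
sedge-< {k} {x} {y} (inj₂ (t , i , t<k , i<k , refl , eq)) = ℕₚ.+-cancelʳ-< (suc i) x y (begin-strict
  k + 2 * k * t + i + suc i   ≡⟨ ℕₚ.+-assoc (k + 2 * k * t) i (suc i) ⟩
  k + 2 * k * t + (i + suc i) <⟨ ℕₚ.+-monoʳ-< (k + 2 * k * t) (ℕₚ.+-mono-<-≤ i<k i<k) ⟩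
  k + 2 * k * t + (k + k)     ≡⟨ shift₁ k t ⟩
  k + 2 * k * t + 2 * k       ≡⟨ sym eq ⟩
  y + i + 1                   ≡⟨ shift₂ y i ⟩
  y + suc i                   ∎)
  where
  open ℕₚ.≤-Reasoning
  shift₁ : ∀ k t → k + 2 * k * t + (k + k) ≡ k + 2 * k * t + 2 * k
  shift₁ = solve-∀
  shift₂ : ∀ y i → y + i + 1 ≡ y + suc i
  shift₂ = solve-∀

clique⇒stIves : ∀ {B k} xs → AllPairs (λ x y → x ≺ y × (x , y , red) ∈ B) xs →
  size (S' k) ≤ length xs → CopyInℚ B red (S' k)
clique⇒stIves {k = k} xs clique size≤ = copyFromList (S' k) xs (AllPairs.map proj₁ clique) size≤
  λ i j e p q → proj₂ (at-pairs clique (sedge-< e) p q)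

up-deep : ∀ {B n a t s d y z} → Deep B n a t (s + d) y → Up B s y z → Deep B n a (s + t) d z
up-deep p stop = p
up-deep {B} {n} {a} {t} {suc s} {d} {z = z} p (hop x≺y e U) =
  subst (λ m → Deep B n a m d z) (ℕₚ.+-suc s t) (up-deep (step p x≺y e) U)

-- Builder's strategy on ℚ and its cost.

-- The constants of Builder's strategy; the argument c is the cost of what follows.
module Costs (k′ : ℕ) where

  k = suc k′
  M = size (S' k)

  buildCost : ℕ → ℕ
  buildCost zero    = 0
  buildCost (suc s) = M * (buildCost s + M)

  -- Each of `k` piled up copies cuts the path back by `k` vertices, and the jump over them uses
  -- another `k`.
  tailLength : ℕ
  tailLength = k + k * k

  -- The built path keeps `k + tailLength` edges beyond whichever of its first `k` vertices it is
  -- joined at. One `k` pays for the nested edges, the other for up to `k` lost path vertices.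
  connectCost : ℕ → ℕ
  connectCost c = buildCost (k + (k + tailLength)) + (k + (k + c))

  pushCost : ℕ → ℕ → ℕ
  pushCost zero    c = connectCost c
  pushCost (suc j) c = suc (connectCost (pushCost j c))

  levelCost : ℕ → ℕ
  levelCost c = suc (pushCost k c)

  surroundCost : ℕ → ℕ → ℕ
  surroundCost zero    c = levelCost c
  surroundCost (suc j) c = levelCost (surroundCost j c)

  packCost : ℕ → ℕ
  packCost zero    = 0
  packCost (suc j) = surroundCost k′ (connectCost (packCost j))

  totalCost : ℕ
  totalCost = buildCost tailLength + surroundCost k′ (packCost k)

  c≤connectCost : ∀ c → c ≤ connectCost c
  c≤connectCost c = ℕₚ.≤-trans (ℕₚ.m≤n+m c k)
    (ℕₚ.≤-trans (ℕₚ.m≤n+m _ k) (ℕₚ.m≤n+m _ (buildCost (k + (k + tailLength)))))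

  c≤pushCost : ∀ j c → c ≤ pushCost j c
  c≤pushCost zero    c = c≤connectCost c
  c≤pushCost (suc j) c = ℕₚ.m≤n⇒m≤1+n (ℕₚ.≤-trans (c≤pushCost j c) (c≤connectCost _))

module Strategy (k′ n : ℕ) where

  open Costs k′

  Wins : ℕ → Boardℚ → Set
  Wins = Winsℚ (S' k) (P n)

  winRed : ∀ {m B} → CopyInℚ B red (S' k) → Wins m B
  winRed copy = done (inj₁ copy)

  -- Builder stops at the first blue edge; the sorting of `xs` keeps the later edges new.
  star : ∀ {B a b r} x xs → Inside a b x → AllPairs _≺_ xs →
    All (λ y → x ≺ y × y ≺ b × ¬ Drawnℚ B x y) xs →
    (∀ {B′ y} → Extends B B′ a b → y ∈ xs → (x , y , blue) ∈ B′ → Wins r B′) →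
    (∀ {B′} → Extends B B′ a b → All (λ y → (x , y , red) ∈ B′) xs → Wins r B′) →
    Wins (length xs + r) B
  star x [] x∈ _ _ onBlue onRed = onRed extends-refl []
  star {B} {a} {b} {r} x (y ∷ ys) x∈ (y≺ys ∷ sorted) ((x≺y , y≺b , new) ∷ hyps) onBlue onRed =
    move x y x≺y new λ
      { blue → weaken (ℕₚ.m≤n+m r (length ys)) (onBlue first (here refl) (here refl))
      ; red  → star x ys x∈ sorted (All.zipWith still (y≺ys , hyps))
                 (λ E y∈ → onBlue (extends-trans first E) (there y∈))
                 (λ E reds → onRed (extends-trans first E) (incl E (here refl) ∷ reds)) }
    where
    first : ∀ {c} → Extends B ((x , y , c) ∷ B) a b
    first = extends-∷ x∈ (ℚₚ.<-trans (proj₁ x∈) x≺y , y≺b)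
    still : ∀ {z} → y ≺ z × (x ≺ z × z ≺ b × ¬ Drawnℚ B x z) →
            x ≺ z × z ≺ b × ¬ Drawnℚ ((x , y , red) ∷ B) x z
    still {z} (y≺z , x≺z , z≺b , new) = x≺z , z≺b , new′
      where
      new′ : ¬ Drawnℚ ((x , y , red) ∷ B) x z
      new′ e with drawn-∷⁻ e
      ... | inj₁ (_ , refl)           = ℚₚ.<-irrefl refl y≺z
      ... | inj₂ (inj₁ (refl , refl)) = ℚₚ.<-irrefl refl x≺z
      ... | inj₂ (inj₂ e′)            = new e′

  -- A Ramsey argument by induction on `s`: in an untouched interval, a blue path costs a number of
  -- moves that depends on `s` and `k` only.
  build : ∀ s {B a b r} → a ≺ b → Fresh B a b →
    (∀ {B′ y z} → Extends B B′ a b → Up B′ s y z → a ≺ y → z ≺ b → Wins r B′) →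
    Wins (buildCost s + r) B
  -- Starts of blue paths with s edges are collected from right to left; a blue edge from a new
  -- start to an old one lengthens the path, and M starts joined by red edges only contain S'_k.
  collect : ∀ s i {B a p b r} xs → i + length xs ≡ M → a ≺ p → p ≼ b → Fresh B a p →
    AllPairs (λ x y → x ≺ y × (x , y , red) ∈ B) xs →
    All (λ x → p ≼ x × x ≺ b × ∃ λ z → Up B s x z × z ≺ b) xs →
    (∀ {B′ y z} → Extends B B′ a b → Up B′ (suc s) y z → a ≺ y → z ≺ b → Wins r B′) →
    Wins (i * (buildCost s + M) + r) B

  build zero a≺b fresh cont with ℚₚ.<-dense a≺b
  ... | y , a≺y , y≺b = cont extends-refl stop a≺y y≺b
  build (suc s) a≺b fresh cont =
    collect s M [] (ℕₚ.+-identityʳ M) a≺b ℚₚ.≤-refl fresh [] [] cont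

  collect s zero xs eq _ _ _ clique _ _ =
    winRed (clique⇒stIves xs clique (ℕₚ.≤-reflexive (sym eq)))
  collect s (suc i) {B} {a} {p} {b} {r} xs eq a≺p p≼b fresh clique paths cont
    -- The next path goes into (m , p), left of all earlier starts; (a , m) stays untouched for
    -- later rounds.
    with m , a≺m , m≺p ← ℚₚ.<-dense a≺p =
    subst (λ q → Wins q B) (shift (buildCost s) M i r)
      (build s m≺p (λ e m≺v → fresh e (ℚₚ.<-trans a≺m m≺v)) newStart)
    where
    shift : ∀ F M i r → F + (M + (i * (F + M) + r)) ≡ (F + M) + i * (F + M) + r
    shift = solve-∀

    a≼m = ℚₚ.<⇒≤ a≺m
    m≼p = ℚₚ.<⇒≤ m≺p

    size-bound : length xs ≤ M
    size-bound = subst (length xs ≤_) eq (ℕₚ.m≤n+m (length xs) (suc i))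

    newStart : ∀ {B₁ x z} → Extends B B₁ m p → Up B₁ s x z → m ≺ x → z ≺ p →
               Wins (M + (i * (buildCost s + M) + r)) B₁
    newStart {B₁} {x} {z} E₁ U m≺x z≺p =
      weaken (ℕₚ.+-monoˡ-≤ _ size-bound)
        (star x xs (m≺x , ℚₚ.<-≤-trans x≺p p≼b) (AllPairs.map proj₁ clique)
          (All.map (λ (p≼y , y≺b , _) → ℚₚ.<-≤-trans x≺p p≼y , y≺b , undrawn p≼y) paths)
          onBlue onRed)
      where
      x≺p = ℚₚ.≤-<-trans (up-≼ U) z≺p

      -- An older edge would touch the fresh interval at `x`, and the edges just drawn end below
      -- `p`.
      undrawn : ∀ {y} → p ≼ y → ¬ Drawnℚ B₁ x y
      undrawn p≼y e with local E₁ e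
      ... | inj₁ e′               = fresh (drawn-sym e′) (ℚₚ.<-trans a≺m m≺x) x≺p
      ... | inj₂ (_ , _ , y≺p) = ℚₚ.<-irrefl refl (ℚₚ.<-≤-trans y≺p p≼y)

      E₁′ : Extends B B₁ m b
      E₁′ = extends-widen ℚₚ.≤-refl p≼b E₁

      onBlue : ∀ {B₂ y} → Extends B₁ B₂ m b → y ∈ xs → (x , y , blue) ∈ B₂ →
               Wins (i * (buildCost s + M) + r) B₂
      onBlue E₂ y∈ e with p≼y , _ , _ , V , z′≺b ← All.lookup paths y∈ =
        weaken (ℕₚ.m≤n+m r _)
          (cont (extends-widen a≼m ℚₚ.≤-refl E) (hop (ℚₚ.<-≤-trans x≺p p≼y) e (up-mono (incl E) V))
                (ℚₚ.<-trans a≺m m≺x) z′≺b)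
        where
        E = extends-trans E₁′ E₂

      onRed : ∀ {B₂} → Extends B₁ B₂ m b → All (λ y → (x , y , red) ∈ B₂) xs →
              Wins (i * (buildCost s + M) + r) B₂
      onRed E₂ reds =
        collect s i (x ∷ xs) (trans (ℕₚ.+-suc i (length xs)) eq) a≺m (ℚₚ.≤-trans m≼p p≼b)
          (fresh-before m≼p fresh E)
          (All.zipWith (λ ((p≼y , _) , e) → ℚₚ.<-≤-trans x≺p p≼y , e) (paths , reds) ∷
            AllPairs.map (λ (x≺y , e) → x≺y , incl E e) clique)
          ((ℚₚ.<⇒≤ m≺x , ℚₚ.<-≤-trans x≺p p≼b ,
              z , up-mono (incl E₂) U , ℚₚ.<-≤-trans z≺p p≼b) ∷
            All.map (λ (p≼y , y≺b , z′ , V , z′≺b) →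
              ℚₚ.≤-trans m≼p p≼y , y≺b , z′ , up-mono (incl E) V , z′≺b) paths)
          (λ E₃ → cont (extends-trans (extends-widen a≼m ℚₚ.≤-refl E) E₃))
        where
        E = extends-trans E₁′ E₂

  -- The invariant that makes every edge still to be drawn by `glue` new.
  Separated : Boardℚ → ℚ → ℚ → ℚ → Set
  Separated B v y z = ∀ {a b} → Drawnℚ B a b → a ≼ v → y ≼ b → ¬ (b ≼ z)

  -- The edges from the last j path vertices to the first j vertices of U are nested, so drawing
  -- them from the inside out either joins the two paths or yields a red matching.
  glue : ∀ j {B ℓ t d v s y z a i c e r} →
    Deep B n ℓ (j + t) d v → Up B (j + s) y z → v ≺ y → a ≺ y → Separated B v y z →
    Nest B i v y c e →
    (∀ {B′} → B ⊆ B′ → Deep B′ n a s (j + d) z → Wins r B′) →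
    (∀ {B′ u w} → B ⊆ B′ → Deep B′ n ℓ t (j + d) u → Nest B′ (j + i) u w c e → w ≼ z → Wins r B′) →
    Wins (j + r) B
  glue zero p U v≺y a≺y sep N onBlue onRed = onRed id p N (up-≼ U)
  glue (suc j) {B} {ℓ} {t} {d} {v} {s} {y} {z} {a} {i} {c} {e} {r}
    (step {u = u} p u≺v uv) (hop {y = y′} y≺y′ yy′ U) v≺y a≺y sep N onBlue onRed =
    move v y v≺y (λ vy → sep vy ℚₚ.≤-refl ℚₚ.≤-refl (ℚₚ.≤-trans (ℚₚ.<⇒≤ y≺y′) (up-≼ U)))
      λ { blue → weaken (ℕₚ.m≤n+m r j) (onBlue there joined)
        ; red → glue j (deep-mono there p) (up-mono there U)
                  (ℚₚ.<-trans u≺v (ℚₚ.<-trans v≺y y≺y′)) (ℚₚ.<-trans a≺y y≺y′) sep′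
                  (wrap u≺v v≺y y≺y′ (here refl) (nest-mono there N))
                  (λ {B′} B⊆ q → onBlue (B⊆ ∘ there) (subst (λ m → Deep B′ n a s m z) (ℕₚ.+-suc j d) q))
                  (λ {B′} {u′} {w} B⊆ q N′ → onRed (B⊆ ∘ there)
                    (subst (λ m → Deep B′ n ℓ t m u′) (ℕₚ.+-suc j d) q)
                    (subst (λ m → Nest B′ m u′ w c e) (ℕₚ.+-suc j i) N′)) }
    where
    -- The vertices gained are not credited: the deficit `suc j + d` stays constant along the
    -- recursion and is the one reached if all edges are red.
    joined : Deep ((v , y , blue) ∷ B) n a s (suc j + d) z
    joined = deep-drop (suc j) (subst (λ m → Deep ((v , y , blue) ∷ B) n a m (suc j + d) z)
      (ℕₚ.+-identityʳ (suc j + s))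
      (up-deep {t = 0} (base (step (path-weaken bound (deep-path (deep-mono there (step p u≺v uv)))) v≺y (here refl)) a≺y)
        (up-mono there (hop y≺y′ yy′ U))))
      where
      bound : d ≤ suc (suc j + s + (suc j + d))
      bound = ℕₚ.m≤n⇒m≤1+n (ℕₚ.≤-trans (ℕₚ.m≤n+m d (suc j)) (ℕₚ.m≤n+m (suc j + d) (suc j + s)))
    sep′ : Separated ((v , y , red) ∷ B) u y′ z
    sep′ f a≼u y′≼b b≼z with drawn-∷⁻ f
    ... | inj₁ (refl , refl)        = ℚₚ.<-irrefl refl (ℚₚ.≤-<-trans a≼u u≺v)
    ... | inj₂ (inj₁ (refl , refl)) = ℚₚ.<-irrefl refl (ℚₚ.≤-<-trans a≼u (ℚₚ.<-trans u≺v v≺y))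
    ... | inj₂ (inj₂ f′)            =
      sep f′ (ℚₚ.≤-trans a≼u (ℚₚ.<⇒≤ u≺v)) (ℚₚ.≤-trans (ℚₚ.<⇒≤ y≺y′) y′≼b) b≼z

  -- A jump from the end `v` of the path to just beyond `a`. If it fails, the red copy encloses
  -- everything strictly between `v` and `a`; for `a = v` that is nothing, and the jump merely adds
  -- a copy to the right of `u`.
  connect : ∀ {B ℓ t d v a b c} → Deep B n ℓ (k + t) d v → v ≼ a → a ≺ b →
    (∀ {B′ d′ z} → B ⊆ B′ → Deep B′ n a (k + tailLength) d′ z → z ≺ b → Wins (d′ + c) B′) →
    (∀ {B′ d′ u y} → B ⊆ B′ → a ≺ y → Deep B′ n ℓ t d′ u → Nest B′ k u b v y → Wins (d′ + c) B′) →
    Wins (d + connectCost c) B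
  connect {B} {ℓ} {t} {d} {v} {a} {b} {c} p v≼a a≺b onBlue onRed
    with b′ , a≺b′ , b′≼b , fresh ← freshAfter B a≺b =
    subst (λ m → Wins m B) (shift (buildCost (k + (k + tailLength))) k d c)
      (build (k + (k + tailLength)) a≺b′ fresh λ {B₁} {y} {z} E U a≺y z≺b′ →
        glue k (deep-mono (incl E) p) U (ℚₚ.≤-<-trans v≼a a≺y) a≺y (separated fresh E a≺y z≺b′) hole
          (λ B⊆ q → onBlue (B⊆ ∘ incl E) q (ℚₚ.<-≤-trans z≺b′ b′≼b))
          (λ {B₂} {u} {w} B⊆ q N w≼z → onRed (B⊆ ∘ incl E) a≺y q
            (nest-widenʳ (ℚₚ.≤-trans w≼z (ℚₚ.≤-trans (ℚₚ.<⇒≤ z≺b′) b′≼b))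
              (subst (λ m → Nest B₂ m u w v y) (ℕₚ.+-identityʳ k) N))))
    where
    shift : ∀ F k d c → F + (k + (k + d + c)) ≡ d + (F + (k + (k + c)))
    shift = solve-∀

    separated : ∀ {B₁ b′ y z} → Fresh B a b′ → Extends B B₁ a b′ → a ≺ y → z ≺ b′ → Separated B₁ v y z
    separated fresh E a≺y z≺b′ f x≼v y≼w w≼z with local E f
    ... | inj₁ f′              = fresh f′ (ℚₚ.<-≤-trans a≺y y≼w) (ℚₚ.≤-<-trans w≼z z≺b′)
    ... | inj₂ ((a≺x , _) , _) = ℚₚ.<-irrefl refl (ℚₚ.<-≤-trans a≺x (ℚₚ.≤-trans x≼v v≼a))

  -- A blue edge pays for itself by lowering the deficit, so only the one red edge costs extra.
  extend : ∀ d {B ℓ t v r c} → Deep B n ℓ t d v → v ≺ r →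
    (∀ {B′ d′ x w} → B ⊆ B′ → Deep B′ n ℓ t d′ x → x ≺ w → w ≺ r → (x , w , red) ∈ B′ →
       Wins (d′ + c) B′) →
    Wins (d + suc c) B
  extend zero p v≺r onRed = done (inj₂ (path⇒copy (deep-path p)))
  extend (suc d) {B} {v = v} {c = c} p v≺r onRed
    with b , v≺b , b≼r , fresh ← freshAfter B v≺r
    with w , v≺w , w≺b ← ℚₚ.<-dense v≺b =
    move v w v≺w (λ vw → fresh vw v≺w w≺b) λ
      { blue → extend d (deep-pred (step (deep-mono there p) v≺w (here refl))) (ℚₚ.<-≤-trans w≺b b≼r)
                 (λ B⊆ → onRed (B⊆ ∘ there))
      ; red  → subst (λ m → Wins m ((v , w , red) ∷ B)) (sym (ℕₚ.+-suc d c))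
                 (onRed there (deep-mono there p) v≺w (ℚₚ.<-≤-trans w≺b b≼r) (here refl)) }

  -- xw is the first red edge met at the present level; the jump over k piled up copies lands
  -- between s and w.
  push : ∀ j {R B ℓ d v r s x w ρ c} → R + j ≡ k → Deep B n ℓ (k + j * k) d v → v ≺ r →
    Copies B k R r s → ℓ ≺ x → x ≺ s → s ≺ w → w ≺ ρ → (x , w , red) ∈ B →
    (∀ {B′ d′ z x w} → B ⊆ B′ → ℓ ≺ x → x ≺ w → w ≺ ρ → (x , w , red) ∈ B′ →
       Deep B′ n x (k + tailLength) d′ z → z ≺ w → Wins (d′ + c) B′) →
    Wins (d + pushCost j c) B
  push zero {R} R≡k p v≺r C ℓ≺x x≺s s≺w w≺ρ e cont =
    -- Blue gains the level `xw`; red encloses the `k` copies of the pile.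
    connect p (ℚₚ.<⇒≤ (ℚₚ.<-≤-trans v≺r (copies-≼ C))) s≺w
      (λ B⊆ q z≺w → cont B⊆ ℓ≺x (ℚₚ.<-trans x≺s s≺w) w≺ρ (B⊆ e) (deep-lower (ℚₚ.<⇒≤ x≺s) q) z≺w)
      (λ B⊆ s≺y _ N → winRed (stIves N (subst (λ m → Copies _ k m _ _) (trans (sym (ℕₚ.+-identityʳ R)) R≡k)
        (copies-widenˡ (ℚₚ.<⇒≤ v≺r) (copies-widenʳ (ℚₚ.<⇒≤ s≺y) (copies-mono B⊆ C))))))
  push (suc j) {R} {c = c} R≡k p v≺r C ℓ≺x x≺s s≺w w≺ρ e cont =
    extend _ p v≺r λ {B₁} {d₁} {x′} {w′} B⊆₁ p₁ x′≺w′ w′≺r e₁ →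
      let w′≺ρ = ℚₚ.<-trans w′≺r (ℚₚ.≤-<-trans (copies-≼ C) (ℚₚ.<-trans s≺w w≺ρ)) in
      connect p₁ ℚₚ.≤-refl x′≺w′
        -- Here the level is gained early, with `x′w′` in place of `xw`.
        (λ {B₂} {d₂} B⊆₂ q z≺w′ → weaken (ℕₚ.+-monoʳ-≤ d₂ (c≤pushCost j c))
          (cont (B⊆₂ ∘ B⊆₁) (deep-≺ p₁) x′≺w′ w′≺ρ (B⊆₂ e₁) q z≺w′))
        -- The new copy ends before `w′`, hence left of the pile, and becomes its first member.
        (λ B⊆₂ _ q N → let r′ , u≺r′ , N′ = nest-narrowˡ N in
          push j (trans (sym (ℕₚ.+-suc R j)) R≡k) q u≺r′
            (nest-widenʳ (ℚₚ.<⇒≤ w′≺r) N′ ∷ copies-mono (B⊆₂ ∘ B⊆₁) C)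
            ℓ≺x x≺s s≺w w≺ρ (B⊆₂ (B⊆₁ e))
            (λ B⊆₃ → cont (B⊆₃ ∘ B⊆₂ ∘ B⊆₁)))

  levelUp : ∀ {B ℓ d v ρ c} → Deep B n ℓ tailLength d v → v ≺ ρ →
    (∀ {B′ d′ z x w} → B ⊆ B′ → ℓ ≺ x → x ≺ w → w ≺ ρ → (x , w , red) ∈ B′ →
       Deep B′ n x (k + tailLength) d′ z → z ≺ w → Wins (d′ + c) B′) →
    Wins (d + levelCost c) B
  levelUp p v≺ρ cont = extend _ p v≺ρ λ B⊆ q x≺w w≺ρ e →
    -- The pile starts empty at `s`: copies will go to its left, and the final jump to its right,
    -- below `w`.
    let s , x≺s , s≺w = ℚₚ.<-dense x≺w in
    push k refl q x≺s (none ℚₚ.≤-refl) (deep-≺ q) x≺s s≺w w≺ρ e (λ B⊆′ → cont (B⊆′ ∘ B⊆))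

  -- Each level is gained inside the previous red edge, with `x` and `w` as the new bounds; so
  -- `j = k′` gives a red N_k around the end of the path.
  surround : ∀ j {B ℓ d v ρ c} → Deep B n ℓ tailLength d v → v ≺ ρ →
    (∀ {B′ d′ z x w} → B ⊆ B′ → Nest B′ (suc j) ℓ ρ x w →
       Deep B′ n x (k + tailLength) d′ z → z ≺ w → Wins (d′ + c) B′) →
    Wins (d + surroundCost j c) B
  surround zero p v≺ρ cont = levelUp p v≺ρ λ B⊆ ℓ≺x x≺w w≺ρ e →
    cont B⊆ (wrap ℓ≺x x≺w w≺ρ e hole)
  surround (suc j) p v≺ρ cont = levelUp p v≺ρ λ B⊆ ℓ≺x x≺w w≺ρ e q z≺w →
    surround j (deep-drop k q) z≺w λ B⊆′ N →
      cont (B⊆′ ∘ B⊆) (wrap ℓ≺x x≺w w≺ρ (B⊆′ e) N)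

  -- `N` is the outer matching, `C` the copies to the left of the path's end and `D` those to its
  -- right; each of the `j` remaining rounds adds one copy to `C` or to `D`.
  pack : ∀ j {L R B x y c e ℓ r d v} → L + R + j ≡ k → Nest B k x y c e →
    Copies B k L c ℓ → Copies B k R r e → Deep B n ℓ tailLength d v → v ≺ r →
    Wins (d + packCost j) B
  pack zero {L} {R} {B} {c = c} {e = e} L+R≡k N C D p v≺r =
    winRed (stIves N (subst (λ m → Copies B k m c e) (trans (sym (ℕₚ.+-identityʳ (L + R))) L+R≡k)
      (copies-++ C (ℚₚ.<⇒≤ (ℚₚ.<-trans (deep-≺ p) v≺r)) D)))
  pack (suc j) {L} {R} L+R≡k N C D p v≺r =
    surround k′ p v≺r λ B⊆ N₁ q z≺w →
      let m , m≺r , N₂ = nest-narrowʳ N₁ in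
      connect (deep-lower (ℚₚ.<⇒≤ (nest-left N₁)) q) (ℚₚ.<⇒≤ (ℚₚ.<-trans z≺w (nest-right N₂))) m≺r
        -- The path now ends to the right of `N₂`, which joins the left copies.
        (λ B⊆′ q′ z′≺r → pack j (trans (sym (ℕₚ.+-suc (L + R) j)) L+R≡k)
          (nest-mono (B⊆′ ∘ B⊆) N)
          (copies-snoc (copies-mono (B⊆′ ∘ B⊆) C) (nest-mono B⊆′ N₂))
          (copies-mono (B⊆′ ∘ B⊆) D) (deep-drop k q′) z′≺r)
        -- The failed jump gives the copy `N₃`, which joins the right copies in place of `N₂`; the
        -- path is cut back to its left.
        (λ B⊆′ _ q′ N₃ → let r′ , u≺r′ , N₄ = nest-narrowˡ N₃ in
          pack j (trans (shift L R j) L+R≡k)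
            (nest-mono (B⊆′ ∘ B⊆) N) (copies-mono (B⊆′ ∘ B⊆) C)
            (N₄ ∷ copies-mono (B⊆′ ∘ B⊆) D) q′ u≺r′)
    where
    shift : ∀ L R j → L + suc R + j ≡ L + R + suc j
    shift = solve-∀

  builderWins : Wins (n + totalCost) []
  builderWins = subst (λ m → Wins m []) (shift n (buildCost tailLength) (surroundCost k′ (packCost k)))
    (build tailLength 0≺1 (λ { (_ , inj₁ ()) ; (_ , inj₂ ()) }) λ {B₁} {y} {z} E U 0≺y z≺1 →
      surround k′
        -- The initial path only supplies the tail; its vertices are not credited towards `n`.
        (subst (λ m → Deep B₁ n 0ℚ m n z) (ℕₚ.+-identityʳ tailLength)
          (up-deep {t = 0} (base (start y (ℕₚ.m≤n⇒m≤1+n (ℕₚ.m≤n+m n tailLength))) 0≺y) U))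
        z≺1
        λ B⊆ N q z≺w → pack k refl N (none ℚₚ.≤-refl) (none ℚₚ.≤-refl) (deep-drop k q) z≺w)
    where
    0≺1 : 0ℚ ≺ 1ℚ
    0≺1 = ℚₚ.positive⁻¹ 1ℚ
    shift : ∀ n F c → F + (n + c) ≡ n + (F + c)
    shift = solve-∀

theorem1p7 : (k : ℕ) → 1 ≤ k → Σ ℕ (λ c → (n : ℕ) → 1 ≤ n → RoLe (S' k) (P n) (n + c))
theorem1p7 (suc k′) (s≤s z≤n) = Costs.totalCost k′ , λ n _ → winsℚ⇒roLe (Strategy.builderWins k′ n)
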